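{- Let $q$ be a prime power, let $m,n\ge 1$, and let $\mathcal{C}$ be an $[n,k,d]_{q^m/q}$ code. If $\mathcal{C}$ is rank-metric intersecting, then $n\ge 2k-1$.
   Context: Support and rank: fix an $\mathbb{F}_q$-basis $\Gamma$ of $\mathbb{F}_{q^m}$. For $x=(x_1,\dots,x_n)\in\mathbb{F}_{q^m}^n$ let $\mathrm{Mat}_\Gamma(x)\in\mathbb{F}_q^{m\times n}$ be the matrix whose $j$-th column is the coordinate vector of $x_j$ in the basis $\Gamma$. The support $\sigma(x)\subseteq\mathbb{F}_q^n$ is the $\mathbb{F}_q$-row space of $\mathrm{Mat}_\Gamma(x)$, and $\mathrm{rk}(x)=\dim_{\mathbb{F}_q}\sigma(x)$; both are independent of $\Gamma$. An $[n,k,d]_{q^m/q}$ code is an $\mathbb{F}_{q^m}$-linear subspace $\mathcal{C}$ of $\mathbb{F}_{q^m}^n$ with $k=\dim_{\mathbb{F}_{q^m}}\mathcal{C}\ge 1$ and minimum distance $d=\min_{c\in\mathcal{C}\setminus\{0\}}\mathrm{rk}(c)$. The code is rank-metric intersecting if $\sigma(c)\cap\sigma(c')\ne\{0\}$ for all $c,c'\in\mathcal{C}\setminus\{0\}$. -}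

module Defs where

open import Level using (Level; _⊔_)
open import Algebra.Bundles using (Ring; CommutativeRing)
open import Algebra.Apartness.Bundles using (HeytingField; HeytingCommutativeRing)
open import Algebra.Module.Bundles using (LeftModule)
open import Algebra.Morphism.Structures using (module RingMorphisms)
import Algebra.Construct.Pointwise as Pointwise
import Algebra.Properties.Monoid.Sum as Sum
open import Data.Fin.Base using (Fin)
open import Data.Nat.Base using (ℕ; _≤_; _^_)
open import Data.Nat.Primality using (Prime)
open import Data.Product.Base using (_×_; _,_; ∃-syntax; proj₁; proj₂)
open import Data.Vec.Functional using (Vector)
open import Function.Bundles using (Inverse)
open import Relation.Binary.Bundles using (Setoid)
open import Relation.Binary.PropositionalEquality using (_≡_; setoid)
open import Relation.Nullary.Negation using (¬_)
open import Relation.Unary using (Pred; _∈_; _∩_; _≐_; _⊆_; U)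

IsPrimePower : ℕ → Set
IsPrimePower q = ∃[ p ] ∃[ e ] Prime p × 1 ≤ e × q ≡ p ^ e

IsMinimum : ∀ {p} → Pred ℕ p → ℕ → Set p
IsMinimum P d = d ∈ P × (∀ e → e ∈ P → d ≤ e)

HasCardinality : ∀ {a ℓ} → Setoid a ℓ → ℕ → Set (a ⊔ ℓ)
HasCardinality S N = Inverse S (setoid (Fin N))

-- Fields are Heyting fields. For a field with finitely many elements (in the
-- sense of HasCardinality) both _≈_ and _#_ are decidable, so that x # y is
-- the same as ¬ (x ≈ y), and every element that is not ≈ 0# is invertible.
commutativeRingOf : ∀ {c ℓ₁ ℓ₂} → HeytingField c ℓ₁ ℓ₂ → CommutativeRing c ℓ₁
commutativeRingOf F =
  HeytingCommutativeRing.commutativeRing (HeytingField.heytingCommutativeRing F)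

ringOf : ∀ {c ℓ₁ ℓ₂} → HeytingField c ℓ₁ ℓ₂ → Ring c ℓ₁
ringOf F = CommutativeRing.ring (commutativeRingOf F)

setoidOf : ∀ {c ℓ₁ ℓ₂} → HeytingField c ℓ₁ ℓ₂ → Setoid c ℓ₁
setoidOf F = Ring.setoid (ringOf F)

IsFieldHomomorphism : ∀ {c ℓ₁ ℓ₂ c′ ℓ₁′ ℓ₂′}
  (K : HeytingField c ℓ₁ ℓ₂) (L : HeytingField c′ ℓ₁′ ℓ₂′) →
  (HeytingField.Carrier K → HeytingField.Carrier L) → Set (c ⊔ ℓ₁ ⊔ ℓ₁′)
IsFieldHomomorphism K L =
  RingMorphisms.IsRingHomomorphism (Ring.rawRing (ringOf K)) (Ring.rawRing (ringOf L))

module LinearAlgebra {r ℓr m ℓm} {R : Ring r ℓr} (M : LeftModule R m ℓm) where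
  open Ring R using (Carrier; _≈_; 0#)
  open LeftModule M
  open Sum +ᴹ-monoid using (sum)

  combination : ∀ {k} → Vector Carrier k → Vector Carrierᴹ k → Carrierᴹ
  combination a v = sum (λ i → a i *ₗ v i)

  Span : ∀ {k} → Vector Carrierᴹ k → Pred Carrierᴹ (r ⊔ ℓm)
  Span v x = ∃[ a ] x ≈ᴹ combination a v

  LinearlyIndependent : ∀ {k} → Vector Carrierᴹ k → Set (r ⊔ ℓr ⊔ ℓm)
  LinearlyIndependent v = ∀ a → combination a v ≈ᴹ 0ᴹ → ∀ i → a i ≈ 0#

  record IsSubmodule {p} (W : Pred Carrierᴹ p) : Set (r ⊔ m ⊔ ℓm ⊔ p) where
    field
      resp-≈ᴹ   : ∀ {x y} → x ≈ᴹ y → x ∈ W → y ∈ W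
      0ᴹ-closed : 0ᴹ ∈ W
      +ᴹ-closed : ∀ {x y} → x ∈ W → y ∈ W → (x +ᴹ y) ∈ W
      *ₗ-closed : ∀ a {x} → x ∈ W → (a *ₗ x) ∈ W

  record IsBasis {p} (W : Pred Carrierᴹ p) {k} (v : Vector Carrierᴹ k)
         : Set (r ⊔ ℓr ⊔ m ⊔ ℓm ⊔ p) where
    field
      members     : ∀ i → v i ∈ W
      independent : LinearlyIndependent v
      spanning    : W ⊆ Span v

  HasDimension : ∀ {p} → Pred Carrierᴹ p → ℕ → Set (r ⊔ ℓr ⊔ m ⊔ ℓm ⊔ p)
  HasDimension W k = ∃[ v ] IsBasis W {k} v

  ZeroSpace : Pred Carrierᴹ ℓm
  ZeroSpace x = x ≈ᴹ 0ᴹ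

-- The free module R^n, with pointwise operations and pointwise equality.
coordinateSpace : ∀ {r ℓr} (R : Ring r ℓr) (n : ℕ) → LeftModule R r ℓr
coordinateSpace R n = record
  { Carrierᴹ = Vector Carrier n
  ; _≈ᴹ_ = λ x y → ∀ i → x i ≈ y i
  ; _+ᴹ_ = λ x y i → x i + y i
  ; _*ₗ_ = λ a x i → a * x i
  ; 0ᴹ = λ _ → 0#
  ; -ᴹ_ = λ x i → - x i
  ; isLeftModule = record
    { isLeftSemimodule = record
      { +ᴹ-isCommutativeMonoid =
          Pointwise.isCommutativeMonoid (Fin n) +-isCommutativeMonoid
      ; isPreleftSemimodule = record
        { *ₗ-cong = λ a≈b x≈y i → *-cong a≈b (x≈y i)
        ; *ₗ-zeroˡ = λ x i → zeroˡ (x i)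
        ; *ₗ-distribʳ = λ x a b i → distribʳ (x i) a b
        ; *ₗ-identityˡ = λ x i → *-identityˡ (x i)
        ; *ₗ-assoc = λ a b x i → *-assoc a b (x i)
        ; *ₗ-zeroʳ = λ a i → zeroʳ a
        ; *ₗ-distribˡ = λ a x y i → distribˡ a (x i) (y i)
        }
      }
    ; -ᴹ‿cong = λ x≈y i → -‿cong (x≈y i)
    ; -ᴹ‿inverse = (λ x i → -‿inverseˡ (x i)) , (λ x i → -‿inverseʳ (x i))
    }
  }
  where open Ring R

-- L as a K-vector space, K acting through ι.
extensionSpace : ∀ {c ℓ₁ ℓ₂ c′ ℓ₁′ ℓ₂′}
  (K : HeytingField c ℓ₁ ℓ₂) (L : HeytingField c′ ℓ₁′ ℓ₂′)
  (ι : HeytingField.Carrier K → HeytingField.Carrier L) →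
  IsFieldHomomorphism K L ι → LeftModule (ringOf K) c′ ℓ₁′
extensionSpace K L ι ι-hom = record
  { Carrierᴹ = Carrier
  ; _≈ᴹ_ = _≈_
  ; _+ᴹ_ = _+_
  ; _*ₗ_ = λ a x → ι a * x
  ; 0ᴹ = 0#
  ; -ᴹ_ = -_
  ; isLeftModule = record
    { isLeftSemimodule = record
      { +ᴹ-isCommutativeMonoid = +-isCommutativeMonoid
      ; isPreleftSemimodule = record
        { *ₗ-cong = λ a≈b → *-cong (⟦⟧-cong a≈b)
        ; *ₗ-zeroˡ = λ x → trans (*-congʳ 0#-homo) (zeroˡ x)
        ; *ₗ-distribʳ = λ x a b → trans (*-congʳ (+-homo a b)) (distribʳ x (ι a) (ι b))
        ; *ₗ-identityˡ = λ x → trans (*-congʳ 1#-homo) (*-identityˡ x)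
        ; *ₗ-assoc = λ a b x → trans (*-congʳ (*-homo a b)) (*-assoc (ι a) (ι b) x)
        ; *ₗ-zeroʳ = λ a → zeroʳ (ι a)
        ; *ₗ-distribˡ = λ a → distribˡ (ι a)
        }
      }
    ; -ᴹ‿cong = -‿cong
    ; -ᴹ‿inverse = -‿inverse
    }
  }
  where
  open Ring (ringOf L)
  open RingMorphisms (Ring.rawRing (ringOf K)) (Ring.rawRing (ringOf L))
    using (module IsRingHomomorphism)
  open IsRingHomomorphism ι-hom

module _ {c ℓ₁ ℓ₂ c′ ℓ₁′ ℓ₂′}
  (K : HeytingField c ℓ₁ ℓ₂) (L : HeytingField c′ ℓ₁′ ℓ₂′)
  (ι : HeytingField.Carrier K → HeytingField.Carrier L)
  (ι-hom : IsFieldHomomorphism K L ι)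
  where

  IsFieldBasis : ∀ {m} → Vector (HeytingField.Carrier L) m → Set (c ⊔ ℓ₁ ⊔ c′ ⊔ ℓ₁′)
  IsFieldBasis Γ = LinearAlgebra.IsBasis (extensionSpace K L ι ι-hom) U Γ

  module RankMetric {m : ℕ} (Γ : Vector (HeytingField.Carrier L) m)
    (Γ-basis : IsFieldBasis Γ) (n : ℕ)
    where

    private
      module Kⁿ where
        open LeftModule (coordinateSpace (ringOf K) n) public
        open LinearAlgebra (coordinateSpace (ringOf K) n) public

      module Lⁿ where
        open LeftModule (coordinateSpace (ringOf L) n) public
        open LinearAlgebra (coordinateSpace (ringOf L) n) public

    coordinates : HeytingField.Carrier L → Vector (HeytingField.Carrier K) m
    coordinates y =
      proj₁ (LinearAlgebra.IsBasis.spanning Γ-basis {y} _)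

    -- Indexed by rows: Mat x i j is the i-th coordinate of x j.
    Mat : Lⁿ.Carrierᴹ → Vector Kⁿ.Carrierᴹ m
    Mat x i j = coordinates (x j) i

    σ : Lⁿ.Carrierᴹ → Pred Kⁿ.Carrierᴹ (c ⊔ ℓ₁)
    σ x = Kⁿ.Span (Mat x)

    HasRank : Lⁿ.Carrierᴹ → ℕ → Set (c ⊔ ℓ₁)
    HasRank x = Kⁿ.HasDimension (σ x)

    NonzeroWeights : ∀ {p} → Pred Lⁿ.Carrierᴹ p → Pred ℕ (c ⊔ ℓ₁ ⊔ c′ ⊔ ℓ₁′ ⊔ p)
    NonzeroWeights C r = ∃[ x ] x ∈ C × x Lⁿ.≉ᴹ Lⁿ.0ᴹ × HasRank x r

    record IsCode {p} (C : Pred Lⁿ.Carrierᴹ p) (k d : ℕ)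
           : Set (c ⊔ ℓ₁ ⊔ c′ ⊔ ℓ₁′ ⊔ p) where
      field
        isSubspace      : Lⁿ.IsSubmodule C
        dimension       : Lⁿ.HasDimension C k
        1≤k             : 1 ≤ k
        minimumDistance : IsMinimum (NonzeroWeights C) d

    IsIntersecting : ∀ {p} → Pred Lⁿ.Carrierᴹ p → Set (c ⊔ ℓ₁ ⊔ c′ ⊔ ℓ₁′ ⊔ p)
    IsIntersecting C = ∀ x y → x ∈ C → x Lⁿ.≉ᴹ Lⁿ.0ᴹ → y ∈ C → y Lⁿ.≉ᴹ Lⁿ.0ᴹ →
      ¬ ((σ x ∩ σ y) ≐ Kⁿ.ZeroSpace)

{-# OPTIONS --safe #-}
-- Let k ≥ 1 be the dimension of C.  If n ≤ 2 (k - 1), write n = a + b with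
-- a, b < k.  Asking the first a coordinates of a codeword to vanish imposes
-- fewer than k linear conditions on C, so some nonzero codeword x satisfies
-- them; likewise some nonzero codeword y vanishes on the last b coordinates.
-- A vector in σ(x) vanishes wherever x does, so σ(x) ∩ σ(y) = {0}.
module Submission where

open import Defs
open import Algebra.Apartness.Bundles using (HeytingField)
open import Algebra.Bundles using (CommutativeRing; Ring)
open import Algebra.Module.Bundles using (LeftModule)
import Algebra.Apartness.Properties.HeytingCommutativeRing as HeytingProperties
import Algebra.Properties.Ring as RingProperties
import Algebra.Properties.Semiring.Sum as SemiringSum
open import Data.Fin.Base using (Fin; zero; suc; _↑ˡ_; _↑ʳ_; punchIn; splitAt; join)
open import Data.Fin.Properties
  using (all?; ¬∀⟶∃¬; join-splitAt; punchIn-punchOut) renaming (_≟_ to _≟ᶠ_)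
open import Data.Nat.Base using (ℕ; zero; suc; _∸_; _^_; _⊓_; _≤_; _<_; _≥_; s≤s; s≤s⁻¹)
open import Data.Nat.Properties
  using (_≤?_; ≰⇒>; m⊓n≤m; m⊓n+n∸m≡n; m≤n+o⇒m∸n≤o; +-suc; +-identityʳ)
open import Data.Product.Base using (_×_; _,_; ∃-syntax; proj₁; proj₂)
open import Data.Sum.Base using (inj₁; inj₂)
open import Data.Vec.Functional using (Vector; _∷_; replicate; tail)
open import Function.Base using (_∘_)
open import Function.Properties.Inverse using (Inverse⇒Injection)
open import Relation.Binary.Bundles using (Setoid)
open import Relation.Binary.Definitions using (Decidable)
open import Relation.Binary.PropositionalEquality as ≡ using (_≡_)
open import Relation.Nullary.Decidable using (yes; no; via-injection)
open import Relation.Nullary.Negation using (¬_; contradiction)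
open import Relation.Unary using (Pred; _∈_)

module CoordinateSpaceProperties {r ℓr} (R : Ring r ℓr) where
  open Ring R hiding (zero)
  open SemiringSum semiring using (sum; sum-cong-≋; sum-replicate-zero)

  private
    module M (n : ℕ) = LinearAlgebra (coordinateSpace R n)

  -- Evaluation at a coordinate commutes with sums, but for a variable `k` only induction exposes
  -- the scalar sum, to which the summation laws of the ring apply.
  combination-apply : ∀ {k n} (a : Vector Carrier k) (v : Vector (Vector Carrier n) k) j →
    M.combination n a v j ≡ sum (λ i → a i * v i j)
  combination-apply {zero}  a v j = ≡.refl
  combination-apply {suc k} a v j =
    ≡.cong (a zero * v zero j +_) (combination-apply (tail a) (tail v) j)

  sum-zero : ∀ {k} {u : Vector Carrier k} → (∀ i → u i ≈ 0#) → sum u ≈ 0#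
  sum-zero {k} u≈0 = trans (sum-cong-≋ u≈0) (sum-replicate-zero k)

  combination-vanishes : ∀ {k n} (a : Vector Carrier k) (v : Vector (Vector Carrier n) k) j →
    (∀ i → v i j ≈ 0#) → M.combination n a v j ≈ 0#
  combination-vanishes a v j vj≈0 = trans (reflexive (combination-apply a v j))
    (sum-zero (λ i → trans (*-congˡ (vj≈0 i)) (zeroʳ (a i))))

  combination-zeroˡ : ∀ {k n} (v : Vector (Vector Carrier n) k) j →
    M.combination n (replicate k 0#) v j ≈ 0#
  combination-zeroˡ v j = trans (reflexive (combination-apply _ v j))
    (sum-zero (λ i → zeroˡ (v i j)))

module SubmoduleProperties {r ℓr m ℓm} {R : Ring r ℓr} (M : LeftModule R m ℓm) where
  open LeftModule M
  open LinearAlgebra M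

  combination-closed : ∀ {p} {W : Pred Carrierᴹ p} → IsSubmodule W →
    ∀ {k} a (v : Vector Carrierᴹ k) → (∀ i → v i ∈ W) → combination a v ∈ W
  combination-closed W {zero}  a v v∈W = IsSubmodule.0ᴹ-closed W
  combination-closed W {suc k} a v v∈W = IsSubmodule.+ᴹ-closed W
    (IsSubmodule.*ₗ-closed W (a zero) (v∈W zero))
    (combination-closed W (tail a) (tail v) (v∈W ∘ suc))

-- Elements are compared through their images in `Fin N`. Elimination relies on this to search for a
-- nonzero pivot.
finite⇒≈-decidable : ∀ {a ℓ} (S : Setoid a ℓ) {N} → HasCardinality S N →
  Decidable (Setoid._≈_ S)
finite⇒≈-decidable S S↔N = via-injection (Inverse⇒Injection S↔N) _≟ᶠ_

module DiscreteField {c ℓ₁ ℓ₂} (F : HeytingField c ℓ₁ ℓ₂)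
  (_≟_ : Decidable (HeytingField._≈_ F)) where

  open HeytingField F using (heytingCommutativeRing; tight; #-irrefl)
  open HeytingProperties heytingCommutativeRing using (1#0; x#0y#0→xy#0)
  open CommutativeRing (commutativeRingOf F) hiding (zero)
  open RingProperties (ringOf F) using (-‿distribˡ-*)
  open SemiringSum semiring
    using (sum; sum-cong-≋; ∑-distrib-+; *-distribʳ-sum)
  open CoordinateSpaceProperties (ringOf F)
  open import Relation.Binary.Reasoning.Setoid setoid

  1≉0 : ¬ 1# ≈ 0#
  1≉0 1≈0 = #-irrefl 1≈0 1#0

  -- Tightness reduces each factor to the case where it is apart from zero; the product is then
  -- apart from zero as well, against irreflexivity.
  *-≉0 : ∀ {x y} → ¬ x ≈ 0# → ¬ y ≈ 0# → ¬ x * y ≈ 0#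
  *-≉0 x≉0 y≉0 xy≈0 = x≉0 (proj₁ (tight _ _) λ x#0 →
    y≉0 (proj₁ (tight _ _) λ y#0 → #-irrefl xy≈0 (x#0y#0→xy#0 x#0 y#0)))

  private
    combination : ∀ {n k} → Vector Carrier k → Vector (Vector Carrier n) k → Vector Carrier n
    combination {n} = LinearAlgebra.combination (coordinateSpace (ringOf F) n)

  -- Fraction-free elimination: the vector v (suc i) is replaced by its
  -- combination with v zero that vanishes at the pivot coordinate p.
  dependent : ∀ {m n} → m < n → (v : Vector (Vector Carrier m) n) →
    ∃[ a ] (∀ j → combination a v j ≈ 0#) × ∃[ i ] ¬ a i ≈ 0#
  dependent {m} {suc n} m<n v with all? (λ j → v zero j ≟ 0#)
  ... | yes v₀≈0 = 1# ∷ replicate n 0#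
    , (λ j → trans (+-cong (trans (*-congˡ (v₀≈0 j)) (zeroʳ 1#)) (combination-zeroˡ (tail v) j))
                   (+-identityˡ 0#))
    , zero , 1≉0
  dependent {zero}  {suc n} m<n v | no v₀≉0 = contradiction (λ ()) v₀≉0
  dependent {suc m} {suc n} m<n v | no v₀≉0 = result
    where
    pivot = ¬∀⟶∃¬ (suc m) _ (λ j → v zero j ≟ 0#) v₀≉0
    p     = proj₁ pivot

    w : Vector (Vector Carrier (suc m)) n
    w i j = - v (suc i) p * v zero j + v zero p * v (suc i) j

    result : ∃[ a ] (∀ j → combination a v j ≈ 0#) × ∃[ i ] ¬ a i ≈ 0#
    -- Every `w i` vanishes at `p`, so deleting that coordinate loses nothing and leaves `n` vectors
    -- of length `m`.
    result with dependent (s≤s⁻¹ m<n) (λ i j → w i (punchIn p j))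
    ... | b , bw≈0 , i , bᵢ≉0 = a , av≈0 , suc i , *-≉0 bᵢ≉0 (proj₂ pivot)
      where
      a : Vector Carrier (suc n)
      -- These are the coefficients of the `v i` once each `w i` is expanded in the relation `b`.
      a = sum (λ i → b i * - v (suc i) p) ∷ λ i → b i * v zero p

      av≈bw : ∀ j → combination a v j ≈ sum (λ i → b i * w i j)
      av≈bw j = begin
        combination a v j
          ≡⟨ combination-apply a v j ⟩
        a zero * v zero j + sum (λ i → a (suc i) * v (suc i) j)
          ≈⟨ +-congʳ (*-distribʳ-sum (v zero j) (λ i → b i * - v (suc i) p)) ⟩
        sum (λ i → b i * - v (suc i) p * v zero j) + sum (λ i → a (suc i) * v (suc i) j)
          ≈⟨ ∑-distrib-+ (λ i → b i * - v (suc i) p * v zero j) (λ i → a (suc i) * v (suc i) j) ⟨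
        sum (λ i → b i * - v (suc i) p * v zero j + a (suc i) * v (suc i) j)
          ≈⟨ sum-cong-≋ {n} (λ i →
               trans (+-cong (*-assoc _ _ _) (*-assoc _ _ _)) (sym (distribˡ (b i) _ _))) ⟩
        sum (λ i → b i * w i j) ∎

      wp≈0 : ∀ i → w i p ≈ 0#
      wp≈0 i = trans (+-cong (sym (-‿distribˡ-* _ _)) (*-comm _ _)) (-‿inverseˡ _)

      bw≈0′ : ∀ j → sum (λ i → b i * w i j) ≈ 0#
      -- Coordinates other than `p` lie in the range of `punchIn p`, where the recursive relation
      -- applies.
      bw≈0′ j with p ≟ᶠ j
      ... | yes ≡.refl = sum-zero (λ i → trans (*-congˡ (wp≈0 i)) (zeroʳ (b i)))
      ... | no p≢j = ≡.subst (λ j → sum (λ i → b i * w i j) ≈ 0#) (punchIn-punchOut p≢j)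
        (trans (reflexive (≡.sym (combination-apply b _ _))) (bw≈0 _))

      av≈0 : ∀ j → combination a v j ≈ 0#
      av≈0 j = trans (av≈bw j) (bw≈0′ j)

open import Data.Nat.Base using (_+_; _*_)

module _ {c ℓ₁ ℓ₂ c′ ℓ₁′ ℓ₂′}
  (K : HeytingField c ℓ₁ ℓ₂) (L : HeytingField c′ ℓ₁′ ℓ₂′)
  (_≟_ : Decidable (HeytingField._≈_ L))
  (ι : HeytingField.Carrier K → HeytingField.Carrier L)
  (ι-hom : IsFieldHomomorphism K L ι)
  {m : ℕ} (Γ : Vector (HeytingField.Carrier L) m) (Γ-basis : IsFieldBasis K L ι ι-hom Γ)
  where

  private
    module K = Ring (ringOf K)
    module L = Ring (ringOf L)
    module Γ = LinearAlgebra.IsBasis Γ-basis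
    module Lⁿ (n : ℕ) = LinearAlgebra (coordinateSpace (ringOf L) n)
    module RM = RankMetric K L ι ι-hom Γ Γ-basis

  open CoordinateSpaceProperties
  open SubmoduleProperties

  -- If `x j` is zero, independence of `Γ` makes the whole `j`-th column of the matrix zero, hence
  -- also the `j`-th entry of any combination of its rows.
  support-vanishes : ∀ {n} (x : Vector L.Carrier n) {z} → z ∈ RM.σ n x →
    ∀ {j} → x j L.≈ L.0# → z j K.≈ K.0#
  support-vanishes {n} x (a , z≈ax) {j} xj≈0 = K.trans (z≈ax j)
    (combination-vanishes (ringOf K) a (RM.Mat n x) j
      (Γ.independent _ (L.trans (L.sym (proj₂ (Γ.spanning {x j} _))) xj≈0)))

  zero∈support : ∀ {n} (x : Vector L.Carrier n) {z} → (∀ j → z j K.≈ K.0#) → z ∈ RM.σ n x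
  zero∈support {n} x z≈0 = replicate m K.0# ,
    λ j → K.trans (z≈0 j) (K.sym (combination-zeroˡ (ringOf K) (RM.Mat n x) j))

  -- Restricted to the `s` positions chosen by `f`, the `k` basis vectors of `C` become dependent.
  -- The same coefficients applied to the full basis vectors give `x`, which is nonzero because the
  -- basis is independent.
  shortened-codeword : ∀ {p n k s} {C : Pred (Vector L.Carrier n) p} →
    Lⁿ.IsSubmodule n C → Lⁿ.HasDimension n C k → s < k → (f : Fin s → Fin n) →
    ∃[ x ] x ∈ C × ¬ (∀ j → x j L.≈ L.0#) × (∀ i → x (f i) L.≈ L.0#)
  shortened-codeword {n = n} C (v , v-basis) s<k f
    with DiscreteField.dependent L _≟_ s<k (λ i → v i ∘ f)
  ... | a , af≈0 , i , aᵢ≉0 = Lⁿ.combination n a v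
    , combination-closed (coordinateSpace (ringOf L) n) C a v (Lⁿ.IsBasis.members v-basis)
    , (λ av≈0 → aᵢ≉0 (Lⁿ.IsBasis.independent v-basis a av≈0 i))
    , λ i → L.trans (L.reflexive (≡.trans (combination-apply (ringOf L) a v (f i))
        (≡.sym (combination-apply (ringOf L) a (λ i → v i ∘ f) i)))) (af≈0 i)

  short-code-not-intersecting : ∀ {p n k d a b} {C : Pred (Vector L.Carrier n) p} →
    RM.IsCode n C k d → a < k → b < k → n ≡ a + b → ¬ RM.IsIntersecting n C
  short-code-not-intersecting {a = a} {b} C a<k b<k ≡.refl C-intersecting
    with shortened-codeword C.isSubspace C.dimension a<k (_↑ˡ b)
       | shortened-codeword C.isSubspace C.dimension b<k (a ↑ʳ_)
    where module C = RM.IsCode _ C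
  ... | x , x∈C , x≉0 , xˡ≈0 | y , y∈C , y≉0 , yʳ≈0 =
    C-intersecting x y x∈C x≉0 y∈C y≉0
      ( (λ {z} (z∈σx , z∈σy) j → ≡.subst (λ j → z j K.≈ K.0#) (join-splitAt a b j)
          (vanishes z∈σx z∈σy (splitAt a j)))
      -- The trivial inclusion is also due, since the intersection must equal the zero space.
      , λ z≈0 → zero∈support x z≈0 , zero∈support y z≈0 )
    where
    vanishes : ∀ {z} → z ∈ RM.σ _ x → z ∈ RM.σ _ y → ∀ j → z (join a b j) K.≈ K.0#
    vanishes z∈σx z∈σy (inj₁ i) = support-vanishes x z∈σx (xˡ≈0 i)
    vanishes z∈σx z∈σy (inj₂ i) = support-vanishes y z∈σy (yʳ≈0 i)

<2k-1⇒split : ∀ {n k} → 1 ≤ k → n < 2 * k ∸ 1 → ∃[ a ] ∃[ b ] a < k × b < k × n ≡ a + b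
-- The first block is as long as allowed, at most `k`; the remaining `n ∸ k` positions number at
-- most `k` because `n ≤ k + k`.
<2k-1⇒split {n} {suc k} _ n<2k-1 = k ⊓ n , n ∸ k , s≤s (m⊓n≤m k n)
  , s≤s (m≤n+o⇒m∸n≤o n k n≤k+k)
  , ≡.sym (m⊓n+n∸m≡n k n)
  where
  n≤k+k : n ≤ k + k
  -- For dimension `suc k` the bound computes to `k + suc (k + 0)`, which is rewritten to
  -- `suc (k + k)`.
  n≤k+k = s≤s⁻¹ (≡.subst (n <_)
    (≡.trans (+-suc k (k + 0)) (≡.cong (λ j → suc (k + j)) (+-identityʳ k))) n<2k-1)

corollary2p4 : ∀ {c ℓ₁ ℓ₂ c′ ℓ₁′ ℓ₂′ p}
    (q m n k d : ℕ) → IsPrimePower q → 1 ≤ m → 1 ≤ n →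
    (K : HeytingField c ℓ₁ ℓ₂) → HasCardinality (setoidOf K) q →
    (L : HeytingField c′ ℓ₁′ ℓ₂′) → HasCardinality (setoidOf L) (q ^ m) →
    (ι : HeytingField.Carrier K → HeytingField.Carrier L) →
    (ι-hom : IsFieldHomomorphism K L ι) →
    (Γ : Vector (HeytingField.Carrier L) m) (Γ-basis : IsFieldBasis K L ι ι-hom Γ) →
    (C : Pred (Vector (HeytingField.Carrier L) n) p) →
    RankMetric.IsCode K L ι ι-hom Γ Γ-basis n C k d →
    RankMetric.IsIntersecting K L ι ι-hom Γ Γ-basis n C →
    n ≥ 2 * k ∸ 1
corollary2p4 q m n k d _ _ _ K _ L |L|≡qᵐ ι ι-hom Γ Γ-basis C C-code C-intersecting
  -- The order on naturals is decidable, so it suffices to refute the case of a shorter length.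
  with 2 * k ∸ 1 ≤? n
... | yes 2k-1≤n = 2k-1≤n
... | no 2k-1≰n with <2k-1⇒split (RankMetric.IsCode.1≤k C-code) (≰⇒> 2k-1≰n)
... | a , b , a<k , b<k , n≡a+b = contradiction C-intersecting
  (short-code-not-intersecting K L (finite⇒≈-decidable (setoidOf L) |L|≡qᵐ)
    ι ι-hom Γ Γ-basis C-code a<k b<k n≡a+b)
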